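{- Let $A$ be a finite alphabet of size $N \ge 3$, let $\sigma : A \to A$ be a cyclic permutation of $A$ (i.e. $\sigma$ has a single cycle, of length $N$), and let $a_0 \in A$. Let $\delta = \sigma^j$ for some integer $j$ with $1 \le j < N$. If $j \not\equiv 1 \pmod N$, then the infinite word $W_{A,\sigma,a_0}$ is strongly $(3,\delta)$-free.
   Context: Words are finite or infinite sequences of symbols over a finite alphabet $A$; $A^*$ is the set of finite words. A factor of a word is a finite block of consecutive symbols occurring in it. Twisted form: for a permutation $\delta : A \to A$ and a word $w = a_1 a_2 \cdots a_n \in A^*$, the $\delta$-twisted form of $w$ is $w^{(\delta)} = \delta(a_1)\delta(a_2)\cdots\delta(a_n)$. Strongly $(k,\delta)$-repetition: a word $U \in A^*$ is a strongly $(k,\delta)$-repetition if $U = X_0 X_1 \cdots X_{k-1}$ where all $X_i$ have the same length $|X_i| = m \ge 1$ and $X_i = X_0^{(\delta^i)}$ for $i = 0, \dots, k-1$. Here $\delta^0$ is the identity and $\delta^i$ is the $i$-fold composition of $\delta$. Strongly $(k,\delta)$-free: a word $W$ is strongly $(k,\delta)$-free if no factor of $W$ is a strongly $(k,\delta)$-repetition. Cyclic shift morphism: for a permutation $\sigma$ of $A$, $\psi_{A,\sigma} : A^* \to A^*$ is the morphism (with respect to concatenation) defined by $\psi_{A,\sigma}(a) = a\,\sigma(a)$ for each $a \in A$. For $a_0 \in A$, $W_{A,\sigma,a_0} = \lim_{n\to\infty} \psi_{A,\sigma}^n(a_0)$ is the infinite word (indexed by the natural numbers) obtained by iterating $\psi_{A,\sigma}$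 on $a_0$, i.e. the unique one-sided infinite word having every $\psi_{A,\sigma}^n(a_0)$ as a prefix. -}

module Defs where

open import Level using (Level)
open import Data.Nat.Base
open import Data.Nat.Properties
open import Data.Nat.Divisibility using (_∣_)
open import Data.Nat.GeneralisedArithmetic using (fold)
open import Data.Fin.Base using (fromℕ<)
open import Data.List.Base
open import Data.List.Properties
open import Data.Product using (∃-syntax; _,_)
open import Data.Sum using (inj₁; inj₂)
open import Function.Bundles using (_↔_; Inverse)
open import Function.Construct.Composition using (_↔-∘_)
open import Function.Construct.Identity using (↔-id)
open import Relation.Nullary using (¬_)
open import Relation.Binary.PropositionalEquality

private
  variable
    a : Level
    A : Set a

_≡_⟨mod_⟩ : ℕ → ℕ → ℕ → Set
m ≡ n ⟨mod N ⟩ = N ∣ ∣ m - n ∣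

infixr 8 _^ᵖ_

_^ᵖ_ : A ↔ A → ℕ → A ↔ A
π ^ᵖ zero  = ↔-id _
π ^ᵖ suc n = π ↔-∘ (π ^ᵖ n)

-- There is only one cycle: any two letters lie on a common orbit.  On an
-- alphabet of size N that cycle then has length N, and natural exponents
-- suffice because σ has finite order.
IsCyclic : A ↔ A → Set _
IsCyclic σ = ∀ x y → ∃[ n ] Inverse.to (σ ^ᵖ n) x ≡ y

InfWord : Set a → Set a
InfWord A = ℕ → A

factorAt : InfWord A → ℕ → ℕ → List A
factorAt W i n = applyUpTo (λ k → W (i + k)) n

IsFactor : List A → InfWord A → Set _
IsFactor U W = ∃[ i ] ∃[ n ] U ≡ factorAt W i n

twist : A ↔ A → List A → List A
twist δ = map (Inverse.to δ)

-- U = X 0 ++ ⋯ ++ X (k - 1).  The values X i with i ≥ k are irrelevant, and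
-- the notion is meant for k ≥ 1.
record StronglyRepetition {a} {A : Set a}
                          (k : ℕ) (δ : A ↔ A) (U : List A) : Set a where
  field
    X        : ℕ → List A
    m        : ℕ
    m≥1      : m ≥ 1
    U≡concat : U ≡ concat (applyUpTo X k)
    length-X : ∀ i → i < k → length (X i) ≡ m
    X≡twist  : ∀ i → i < k → X i ≡ twist (δ ^ᵖ i) (X 0)

StronglyFree : ℕ → A ↔ A → InfWord A → Set _
StronglyFree k δ W = ∀ U → IsFactor U W → ¬ StronglyRepetition k δ U

ψ : A ↔ A → List A → List A
ψ σ = concatMap (λ x → x ∷ Inverse.to σ x ∷ [])

ψ^ : A ↔ A → ℕ → A → List A
ψ^ σ n x = fold (x ∷ []) (ψ σ) n

length-ψ : ∀ (σ : A ↔ A) w → length (ψ σ w) ≡ 2 * length w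
length-ψ σ []      = refl
length-ψ σ (x ∷ w) =
  trans (cong (2 +_) (length-ψ σ w)) (sym (*-suc 2 (length w)))

n<length-ψ^ : ∀ (σ : A ↔ A) x n → n < length (ψ^ σ n x)
n<length-ψ^ σ x zero    = ≤-refl
n<length-ψ^ σ x (suc n) = begin-strict
  suc n                          ≤⟨ n<length-ψ^ σ x n ⟩
  length (ψ^ σ n x)              <⟨ m<m+n _ (≤-trans (s≤s z≤n) (n<length-ψ^ σ x n)) ⟩
  length (ψ^ σ n x) + length (ψ^ σ n x)
                                 ≡⟨ cong (length (ψ^ σ n x) +_) (+-identityʳ _) ⟨
  2 * length (ψ^ σ n x)          ≡⟨ length-ψ σ (ψ^ σ n x) ⟨
  length (ψ^ σ (suc n) x)        ∎
  where open ≤-Reasoning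

-- The limit word: its n-th letter is read off ψⁿ(a₀), which is longer than n.
-- W-isLimit and limit-unique show that it is the only infinite word having
-- every ψⁿ(a₀) as a prefix.
W : A ↔ A → A → InfWord A
W σ a₀ n = lookup (ψ^ σ n a₀) (fromℕ< (n<length-ψ^ σ a₀ n))

IsLimit : A ↔ A → A → InfWord A → Set _
IsLimit σ a₀ V = ∀ n → factorAt V 0 (length (ψ^ σ n a₀)) ≡ ψ^ σ n a₀

private
  applyUpTo-lookup : ∀ (V : ℕ → A) w →
    (∀ i (i<l : i < length w) → V i ≡ lookup w (fromℕ< i<l)) →
    applyUpTo V (length w) ≡ w
  applyUpTo-lookup V []      h = refl
  applyUpTo-lookup V (x ∷ w) h = cong₂ _∷_ (h 0 (s≤s z≤n))
    (applyUpTo-lookup (λ i → V (suc i)) w (λ i i<l → h (suc i) (s≤s i<l)))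

  lookup-prefix : ∀ (u v : List A) i (p : i < length u) (q : i < length (u ++ v)) →
    lookup u (fromℕ< p) ≡ lookup (u ++ v) (fromℕ< q)
  lookup-prefix (x ∷ u) v zero    p       q       = refl
  lookup-prefix (x ∷ u) v (suc i) (s≤s p) (s≤s q) = lookup-prefix u v i p q

  lookup-applied : ∀ (V : ℕ → A) w → applyUpTo V (length w) ≡ w →
    ∀ i (p : i < length w) → V i ≡ lookup w (fromℕ< p)
  lookup-applied V (x ∷ w) e zero    p       = ∷-injectiveˡ e
  lookup-applied V (x ∷ w) e (suc i) (s≤s p) =
    lookup-applied (λ j → V (suc j)) w (∷-injectiveʳ e) i p

  ψ^-step : ∀ (σ : A ↔ A) x n → ∃[ v ] ψ^ σ (suc n) x ≡ ψ^ σ n x ++ v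
  ψ^-step σ x zero    = Inverse.to σ x ∷ [] , refl
  ψ^-step σ x (suc n) with ψ^-step σ x n
  ... | v , e = ψ σ v , trans (cong (ψ σ) e) (concatMap-++ _ (ψ^ σ n x) v)

  ψ^-prefix : ∀ (σ : A ↔ A) x n d → ∃[ v ] ψ^ σ (d + n) x ≡ ψ^ σ n x ++ v
  ψ^-prefix σ x n zero    = [] , sym (++-identityʳ _)
  ψ^-prefix σ x n (suc d) with ψ^-prefix σ x n d | ψ^-step σ x (d + n)
  ... | v , e | v′ , e′ =
    v ++ v′ , trans e′ (trans (cong (_++ v′) e) (++-assoc (ψ^ σ n x) v v′))

  ψ^-lookup-+ : ∀ (σ : A ↔ A) x i n d
    (p : i < length (ψ^ σ n x)) (q : i < length (ψ^ σ (d + n) x)) →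
    lookup (ψ^ σ n x) (fromℕ< p) ≡ lookup (ψ^ σ (d + n) x) (fromℕ< q)
  ψ^-lookup-+ σ x i n d p q with ψ^ σ (d + n) x | ψ^-prefix σ x n d
  ... | _ | v , refl = lookup-prefix (ψ^ σ n x) v i p q

  ψ^-lookup : ∀ (σ : A ↔ A) x i m n → m ≤ n →
    (p : i < length (ψ^ σ m x)) (q : i < length (ψ^ σ n x)) →
    lookup (ψ^ σ m x) (fromℕ< p) ≡ lookup (ψ^ σ n x) (fromℕ< q)
  ψ^-lookup σ x i m n m≤n p q with n ∸ m | m∸n+n≡m m≤n
  ... | d | refl = ψ^-lookup-+ σ x i m d p q

W-isLimit : ∀ (σ : A ↔ A) a₀ → IsLimit σ a₀ (W σ a₀)
W-isLimit σ a₀ n = applyUpTo-lookup (W σ a₀) (ψ^ σ n a₀) letter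
  where
  letter : ∀ i (p : i < length (ψ^ σ n a₀)) →
           W σ a₀ i ≡ lookup (ψ^ σ n a₀) (fromℕ< p)
  letter i p with ≤-total i n
  ... | inj₁ i≤n = ψ^-lookup σ a₀ i i n i≤n (n<length-ψ^ σ a₀ i) p
  ... | inj₂ n≤i = sym (ψ^-lookup σ a₀ i n i n≤i p (n<length-ψ^ σ a₀ i))

limit-unique : ∀ (σ : A ↔ A) a₀ V → IsLimit σ a₀ V → ∀ n → V n ≡ W σ a₀ n
limit-unique σ a₀ V lim n =
  lookup-applied V (ψ^ σ n a₀) (lim n) n (n<length-ψ^ σ a₀ n)

{-# OPTIONS --safe #-}

-- On the orbit of a₀ the word is the binary digit sum: W(2n) = W(n) and
-- W(2n+1) = σ W(n).  A strong (3,δ)-repetition of block length m gives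
-- W(n+m) = δ W(n) on 2m consecutive n.  If m is even, restricting to even n
-- halves m.  If m = 1, an even n gives σ W(n) = δ W(n).  If m = 2k+1 ≥ 3,
-- comparing n = 2c with n = 2c+1 gives W(c+k+1) = σ² W(c+k) for two
-- consecutive c, while W(x+1) = σ W(x) for the even x = c+k.  So
-- σ = δ or σ = id at some letter, impossible because a cycle of length N has
-- no period below N.

module Submission where

open import Defs
open import Level using (Level)
open import Data.Nat.Base
open import Data.Nat.Properties hiding (<⇒≢)
open import Data.Nat.Divisibility using (_∣0)
open import Data.Nat.DivMod using (_/_; _%_; m≡m%n+[m/n]*n; m%n<n)
open import Data.Nat.Induction using (Acc; acc; <-wellFounded)
open import Data.Fin.Base using (Fin; fromℕ<; toℕ)
open import Data.Fin.Properties using (pigeonhole; fromℕ<-injective; <⇒≢)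
open import Data.List.Base
open import Data.List.Properties
open import Data.Product using (∃-syntax; _×_; _,_; proj₁; proj₂)
open import Data.Sum using (_⊎_; inj₁; inj₂)
open import Function.Base using (_∘_)
open import Function.Bundles using (_↔_; Inverse; Injection)
open import Function.Properties.Inverse using (↔⇒↣)
open import Function.Construct.Symmetry using (↔-sym)
open import Relation.Nullary using (¬_; contradiction)
open import Relation.Binary.PropositionalEquality

private
  variable
    a : Level
    A : Set a

-- Parity of indices, and prefixes and suffixes of words.

even⊎odd : ∀ n → ∃[ k ] (n ≡ k * 2 ⊎ n ≡ 1 + k * 2)
even⊎odd zero = 0 , inj₁ refl
even⊎odd (suc n) with even⊎odd n
... | k , inj₁ e = k     , inj₂ (cong suc e)
... | k , inj₂ e = suc k , inj₁ (cong suc e)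

-- Used to round the start of a window up to an even index, at a cost of at most one position.
nextEven : ∀ n → ∃[ c ] (n ≤ c * 2 × c * 2 ≤ suc n)
nextEven n with even⊎odd n
... | k , inj₁ refl = k     , ≤-refl , n≤1+n _
... | k , inj₂ refl = suc k , n≤1+n _ , ≤-refl

applyUpTo-injective : ∀ {f g : ℕ → A} n → applyUpTo f n ≡ applyUpTo g n →
  ∀ k → k < n → f k ≡ g k
applyUpTo-injective (suc n) e zero    _       = ∷-injectiveˡ e
applyUpTo-injective (suc n) e (suc k) (s≤s p) =
  applyUpTo-injective n (∷-injectiveʳ e) k p

applyUpTo-prefix : ∀ (f : ℕ → A) n u v → applyUpTo f n ≡ u ++ v →
  applyUpTo f (length u) ≡ u
applyUpTo-prefix f n       []      v e = refl
applyUpTo-prefix f (suc n) (x ∷ u) v e = cong₂ _∷_ (∷-injectiveˡ e)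
  (applyUpTo-prefix (f ∘ suc) n u v (∷-injectiveʳ e))

applyUpTo-suffix : ∀ (f : ℕ → A) n u v → applyUpTo f n ≡ u ++ v →
  applyUpTo (λ k → f (length u + k)) (length v) ≡ v
applyUpTo-suffix f n       []      v e =
  applyUpTo-prefix f n v [] (trans e (sym (++-identityʳ v)))
applyUpTo-suffix f (suc n) (x ∷ u) v e =
  applyUpTo-suffix (f ∘ suc) n u v (∷-injectiveʳ e)

-- Recurrences of the limit word at even and odd indices.

ψ∞ : A ↔ A → InfWord A → InfWord A
ψ∞ σ V zero          = V 0
ψ∞ σ V (suc zero)    = Inverse.to σ (V 0)
ψ∞ σ V (suc (suc n)) = ψ∞ σ (V ∘ suc) n

-- Doubling is written `n * 2` because `suc n * 2` computes to `2 + n * 2`, matching the two-step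
-- recursion of `ψ∞`.
ψ∞-even : ∀ (σ : A ↔ A) V n → ψ∞ σ V (n * 2) ≡ V n
ψ∞-even σ V zero    = refl
ψ∞-even σ V (suc n) = ψ∞-even σ (V ∘ suc) n

ψ∞-odd : ∀ (σ : A ↔ A) V n → ψ∞ σ V (1 + n * 2) ≡ Inverse.to σ (V n)
ψ∞-odd σ V zero    = refl
ψ∞-odd σ V (suc n) = ψ∞-odd σ (V ∘ suc) n

ψ∞-prefix : ∀ (σ : A ↔ A) V w → applyUpTo V (length w) ≡ w →
  applyUpTo (ψ∞ σ V) (length (ψ σ w)) ≡ ψ σ w
ψ∞-prefix σ V []      e = refl
ψ∞-prefix σ V (x ∷ w) e =
  cong₂ _∷_ V0≡x (cong₂ _∷_ (cong (Inverse.to σ) V0≡x)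
    (ψ∞-prefix σ (V ∘ suc) w (∷-injectiveʳ e)))
  where V0≡x = ∷-injectiveˡ e

-- `ψ∞` extends `ψ` to infinite words, so it sends a prefix `ψ^ σ n a₀` of `W` to the next iterate.
-- By `limit-unique`, `W` is then a fixed point of `ψ∞`, which yields both recurrences.
ψ∞-W-isLimit : ∀ (σ : A ↔ A) a₀ → IsLimit σ a₀ (ψ∞ σ (W σ a₀))
ψ∞-W-isLimit σ a₀ zero    = refl
ψ∞-W-isLimit σ a₀ (suc n) =
  ψ∞-prefix σ (W σ a₀) (ψ^ σ n a₀) (W-isLimit σ a₀ n)

W-even : ∀ (σ : A ↔ A) a₀ n → W σ a₀ (n * 2) ≡ W σ a₀ n
W-even σ a₀ n = trans
  (sym (limit-unique σ a₀ _ (ψ∞-W-isLimit σ a₀) (n * 2)))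
  (ψ∞-even σ (W σ a₀) n)

W-odd : ∀ (σ : A ↔ A) a₀ n → W σ a₀ (1 + n * 2) ≡ Inverse.to σ (W σ a₀ n)
W-odd σ a₀ n = trans
  (sym (limit-unique σ a₀ _ (ψ∞-W-isLimit σ a₀) (1 + n * 2)))
  (ψ∞-odd σ (W σ a₀) n)

-- Repetitions as shifts on a window.

ShiftsBy : (A → A) → InfWord A → ℕ → ℕ → Set _
ShiftsBy δ V m i = ∀ n → i ≤ n → n < i + m * 2 → V (n + m) ≡ δ (V n)

-- With u the first block and v = u δ(u), the repetition splits both as v δ²(u) and as u δ(v). So δ
-- applied to the prefix v reappears m places later, for each of its 2m letters.
repetition⇒ShiftsBy : ∀ (δ : A ↔ A) (V : InfWord A) {U} → IsFactor U V →
  StronglyRepetition 3 δ U →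
  ∃[ m ] ∃[ i ] (1 ≤ m × ShiftsBy (Inverse.to δ) V m i)
repetition⇒ShiftsBy δ V {U} (i , n , U≡) rep = m , i , m≥1 , shifts
  where
  open StronglyRepetition rep
  open Inverse δ using (to)

  u v : List _
  u = X 0
  v = u ++ map to u

  X₁ : X 1 ≡ map to u
  X₁ = X≡twist 1 (s≤s (s≤s z≤n))

  X₂ : X 2 ≡ map to (map to u)
  X₂ = trans (X≡twist 2 ≤-refl) (map-∘ u)

  U≡u++δv : factorAt V i n ≡ u ++ map to v
  U≡u++δv = begin
    factorAt V i n                        ≡⟨ U≡ ⟨
    U                                     ≡⟨ U≡concat ⟩
    u ++ X 1 ++ X 2 ++ []                 ≡⟨ cong (λ z → u ++ X 1 ++ z) (++-identityʳ (X 2)) ⟩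
    u ++ X 1 ++ X 2                       ≡⟨ cong₂ (λ y z → u ++ y ++ z) X₁ X₂ ⟩
    u ++ map to u ++ map to (map to u)    ≡⟨ cong (u ++_) (map-++ to u (map to u)) ⟨
    u ++ map to v                         ∎
    where open ≡-Reasoning

  U≡v++ : factorAt V i n ≡ v ++ map to (map to u)
  U≡v++ = trans U≡u++δv
    (trans (cong (u ++_) (map-++ to u (map to u))) (sym (++-assoc u _ _)))

  |u| : length u ≡ m
  |u| = length-X 0 (s≤s z≤n)

  |v| : length v ≡ m * 2
  |v| = begin
    length v                       ≡⟨ length-++ u ⟩
    length u + length (map to u)   ≡⟨ cong₂ _+_ |u| (trans (length-map to u) |u|) ⟩
    m + m                          ≡⟨ cong (m +_) (+-identityʳ m) ⟨
    2 * m                          ≡⟨ *-comm 2 m ⟩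
    m * 2                          ∎
    where open ≡-Reasoning

  δv≡ : applyUpTo (λ k → V (i + (length u + k))) (length v)
      ≡ applyUpTo (λ k → to (V (i + k))) (length v)
  δv≡ = begin
    applyUpTo (λ k → V (i + (length u + k))) (length v)
      ≡⟨ cong (applyUpTo _) (length-map to v) ⟨
    applyUpTo (λ k → V (i + (length u + k))) (length (map to v))
      ≡⟨ applyUpTo-suffix _ n u (map to v) U≡u++δv ⟩
    map to v
      ≡⟨ cong (map to) (applyUpTo-prefix _ n v _ U≡v++) ⟨
    map to (factorAt V i (length v))
      ≡⟨ map-applyUpTo _ to (length v) ⟩
    applyUpTo (λ k → to (V (i + k))) (length v)
      ∎
    where open ≡-Reasoning

  shifts : ShiftsBy to V m i
  shifts p i≤p p< with p ∸ i | m+[n∸m]≡n i≤p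
  ... | k | refl = begin
    V (i + k + m)            ≡⟨ cong V (+-assoc i k m) ⟩
    V (i + (k + m))          ≡⟨ cong (λ z → V (i + z)) (+-comm k m) ⟩
    V (i + (m + k))          ≡⟨ cong (λ z → V (i + (z + k))) |u| ⟨
    V (i + (length u + k))   ≡⟨ applyUpTo-injective (length v) δv≡ k
                                  (subst (k <_) (sym |v|) (+-cancelˡ-< i _ _ p<)) ⟩
    to (V (i + k))           ∎
    where open ≡-Reasoning

-- Excluding shifts by means of the two recurrences.

module _ (σ δ : A → A) (V : InfWord A)
         (V-even : ∀ n → V (n * 2) ≡ V n)
         (V-odd  : ∀ n → V (1 + n * 2) ≡ σ (V n))
         (δσ≡σδ  : ∀ x → δ (σ x) ≡ σ (δ x))
         (σ-free : ∀ x → σ x ≢ x)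
         (σ≢δ    : ∀ x → σ x ≢ δ x)
  where

  ¬ShiftsBy-1 : ∀ i → ¬ ShiftsBy δ V 1 i
  ¬ShiftsBy-1 i h with nextEven i
  ... | c , i≤ , ≤i+1 = σ≢δ (V c) (begin
    σ (V c)         ≡⟨ V-odd c ⟨
    V (1 + c * 2)   ≡⟨ cong V (+-comm 1 (c * 2)) ⟩
    -- The window is {i, i + 1}, and `c * 2` is one of these two indices.
    V (c * 2 + 1)   ≡⟨ h (c * 2) i≤ (subst (c * 2 <_) (+-comm 2 i) (s≤s ≤i+1)) ⟩
    δ (V (c * 2))   ≡⟨ cong δ (V-even c) ⟩
    δ (V c)         ∎)
    where open ≡-Reasoning

  ShiftsBy-halve : ∀ k i → ShiftsBy δ V (k * 2) i → ∃[ c ] ShiftsBy δ V k c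
  ShiftsBy-halve k i h with nextEven i
  ... | c , i≤ , ≤i+1 = c , λ n c≤n n< → begin
    V (n + k)           ≡⟨ V-even (n + k) ⟨
    V ((n + k) * 2)     ≡⟨ cong V (*-distribʳ-+ 2 n k) ⟩
    V (n * 2 + k * 2)   ≡⟨ h (n * 2) (≤-trans i≤ (*-monoˡ-≤ 2 c≤n)) (bound n n<) ⟩
    δ (V (n * 2))       ≡⟨ cong δ (V-even n) ⟩
    δ (V n)             ∎
    where
    open ≡-Reasoning
    bound : ∀ n → n < c + k * 2 → n * 2 < i + k * 2 * 2
    -- Doubling n + 1 ≤ c + 2k gives 2n + 2 ≤ 2c + 4k ≤ i + 1 + 4k; the spare unit on the left
    -- absorbs the rounding of i.
    bound n n< = s≤s⁻¹ (≤-trans (*-monoˡ-≤ 2 n<)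
      (≤-trans (≤-reflexive (*-distribʳ-+ 2 c (k * 2)))
               (+-monoˡ-≤ (k * 2 * 2) ≤i+1)))

  -- An odd shift 2k + 1 exchanges parities: 2c goes to 2(c + k) + 1 and 2c + 1 to 2(c + k + 1).
  -- Commuting δ past σ eliminates δ between the two equations.
  double-step : ∀ k c → V (c * 2 + (1 + k * 2)) ≡ δ (V (c * 2)) →
    V (1 + c * 2 + (1 + k * 2)) ≡ δ (V (1 + c * 2)) →
    V (suc (c + k)) ≡ σ (σ (V (c + k)))
  double-step k c e₀ e₁ = begin
    V (suc (c + k))               ≡⟨ V-even (suc (c + k)) ⟨
    V (2 + (c + k) * 2)           ≡⟨ cong (V ∘ suc) shift ⟨
    V (1 + c * 2 + (1 + k * 2))   ≡⟨ e₁ ⟩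
    δ (V (1 + c * 2))             ≡⟨ cong δ (V-odd c) ⟩
    δ (σ (V c))                   ≡⟨ δσ≡σδ (V c) ⟩
    σ (δ (V c))                   ≡⟨ cong (σ ∘ δ) (V-even c) ⟨
    σ (δ (V (c * 2)))             ≡⟨ cong σ e₀ ⟨
    σ (V (c * 2 + (1 + k * 2)))   ≡⟨ cong (σ ∘ V) shift ⟩
    σ (V (1 + (c + k) * 2))       ≡⟨ cong σ (V-odd (c + k)) ⟩
    σ (σ (V (c + k)))             ∎
    where
    open ≡-Reasoning
    shift : c * 2 + (1 + k * 2) ≡ 1 + (c + k) * 2
    shift = trans (+-suc (c * 2) (k * 2)) (cong suc (sym (*-distribʳ-+ 2 c k)))

  -- One of x and x + 1 is even, and after an even index the letter advances by σ only once; a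
  -- second σ would fix a letter.
  ¬double-step-twice : ∀ x → V (suc x) ≡ σ (σ (V x)) →
    ¬ V (suc (suc x)) ≡ σ (σ (V (suc x)))
  ¬double-step-twice x e₀ e₁ with even⊎odd x
  ... | y , inj₁ refl = σ-free (σ (V y))
    (trans (cong (σ ∘ σ) (sym (V-even y))) (trans (sym e₀) (V-odd y)))
  ... | y , inj₂ refl = σ-free (σ (V (suc y)))
    (trans (cong (σ ∘ σ) (sym (V-even (suc y)))) (trans (sym e₁) (V-odd (suc y))))

  -- Here m ≥ 3, so the window has at least six indices. The four from 2c to 2c + 3 lie in it, since
  -- 2c + 3 ≤ i + 4 < i + 6.
  ¬ShiftsBy-odd : ∀ k i → ¬ ShiftsBy δ V (1 + suc k * 2) i
  ¬ShiftsBy-odd k i h with nextEven i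
  ... | c , i≤ , ≤i+1 = ¬double-step-twice (c + suc k)
    (double-step (suc k) c (at 0 z≤n) (at 1 (s≤s z≤n)))
    -- Offsets 2 and 3 form the pair for c + 1, because `suc c * 2` computes to `2 + c * 2`.
    (double-step (suc k) (suc c) (at 2 (s≤s (s≤s z≤n))) (at 3 ≤-refl))
    where
    at : ∀ r → r ≤ 3 →
         V (r + c * 2 + (1 + suc k * 2)) ≡ δ (V (r + c * 2))
    at r r≤3 = h (r + c * 2) (≤-trans i≤ (m≤n+m (c * 2) r))
      (begin-strict
        r + c * 2               ≤⟨ +-mono-≤ r≤3 ≤i+1 ⟩
        4 + i                   <⟨ m<n+m (4 + i) (s≤s (z≤n {1})) ⟩
        6 + i                   ≡⟨ +-comm 6 i ⟩
        i + 6                   ≤⟨ +-monoʳ-≤ i (m≤m+n 6 (k * 2 * 2)) ⟩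
        i + (1 + suc k * 2) * 2 ∎)
      where open ≤-Reasoning

  -- Descent on m: factors of 2 are removed until an odd shift remains. Accessibility is needed
  -- because the half of m is not a structural subterm of it.
  ¬ShiftsBy : ∀ m → Acc _<_ m → 1 ≤ m → ∀ i → ¬ ShiftsBy δ V m i
  ¬ShiftsBy m (acc rs) 1≤m i h with even⊎odd m
  ... | zero  , inj₁ refl = contradiction 1≤m λ ()
  ... | zero  , inj₂ refl = ¬ShiftsBy-1 i h
  ... | suc k , inj₂ refl = ¬ShiftsBy-odd k i h
  ... | suc k , inj₁ refl with ShiftsBy-halve (suc k) i h
  ...   | c , h′ = ¬ShiftsBy (suc k) (rs (m<m*n (suc k) 2 ≤-refl)) (s≤s z≤n) c h′

-- Powers and periods of a cyclic permutation.

^ᵖ-+ : ∀ (σ : A ↔ A) m n x →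
  Inverse.to (σ ^ᵖ (m + n)) x ≡ Inverse.to (σ ^ᵖ m) (Inverse.to (σ ^ᵖ n) x)
^ᵖ-+ σ zero    n x = refl
^ᵖ-+ σ (suc m) n x = cong (Inverse.to σ) (^ᵖ-+ σ m n x)

^ᵖ-comm : ∀ (σ : A ↔ A) n x →
  Inverse.to (σ ^ᵖ n) (Inverse.to σ x) ≡ Inverse.to σ (Inverse.to (σ ^ᵖ n) x)
^ᵖ-comm σ zero    x = refl
^ᵖ-comm σ (suc n) x = cong (Inverse.to σ) (^ᵖ-comm σ n x)

^ᵖ-*-fixed : ∀ (σ : A ↔ A) d x → Inverse.to (σ ^ᵖ d) x ≡ x →
  ∀ q → Inverse.to (σ ^ᵖ (q * d)) x ≡ x
^ᵖ-*-fixed σ d x e zero    = refl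
^ᵖ-*-fixed σ d x e (suc q) = trans (^ᵖ-+ σ d (q * d) x)
  (trans (cong (Inverse.to (σ ^ᵖ d)) (^ᵖ-*-fixed σ d x e q)) e)

^ᵖ-%-fixed : ∀ (σ : A ↔ A) d .{{_ : NonZero d}} x →
  Inverse.to (σ ^ᵖ d) x ≡ x →
  ∀ n → Inverse.to (σ ^ᵖ n) x ≡ Inverse.to (σ ^ᵖ (n % d)) x
^ᵖ-%-fixed σ d x e n = begin
  to^ n x                          ≡⟨ cong (λ k → to^ k x) (m≡m%n+[m/n]*n n d) ⟩
  to^ (n % d + n / d * d) x        ≡⟨ ^ᵖ-+ σ (n % d) (n / d * d) x ⟩
  to^ (n % d) (to^ (n / d * d) x)  ≡⟨ cong (to^ (n % d)) (^ᵖ-*-fixed σ d x e (n / d)) ⟩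
  to^ (n % d) x                    ∎
  where
  open ≡-Reasoning
  to^ : ℕ → _ → _
  to^ k = Inverse.to (σ ^ᵖ k)

-- If the d-th power fixed x, the orbit of x would have at most d letters, one per residue of the
-- exponent. Cyclicity makes that orbit all N letters, so two letters would share a residue.
cyclic-no-short-period : ∀ {N} → A ↔ Fin N → (σ : A ↔ A) → IsCyclic σ →
  ∀ d .{{_ : NonZero d}} → d < N → ∀ x → Inverse.to (σ ^ᵖ d) x ≢ x
cyclic-no-short-period {N = N} A↔Fin σ cyc d d<N x e = no-collision
  (pigeonhole d<N residue)
  where
  letter : Fin N → _
  letter = Inverse.from A↔Fin

  exponent : Fin N → ℕ
  exponent k = proj₁ (cyc x (letter k))

  residue : Fin N → Fin d
  residue k = fromℕ< (m%n<n (exponent k) d)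

  letter≡ : ∀ k → Inverse.to (σ ^ᵖ (exponent k % d)) x ≡ letter k
  letter≡ k = trans (sym (^ᵖ-%-fixed σ d x e (exponent k)))
    (proj₂ (cyc x (letter k)))

  no-collision : ¬ (∃[ k ] ∃[ l ] (toℕ k < toℕ l × residue k ≡ residue l))
  no-collision (k , l , k<l , r) = <⇒≢ k<l
    (Injection.injective (↔⇒↣ (↔-sym A↔Fin)) (begin
      letter k                                ≡⟨ letter≡ k ⟨
      Inverse.to (σ ^ᵖ (exponent k % d)) x    ≡⟨ cong (λ q → Inverse.to (σ ^ᵖ q) x)
                                                   (fromℕ<-injective _ _ (m%n<n _ d) (m%n<n _ d) r) ⟩
      Inverse.to (σ ^ᵖ (exponent l % d)) x    ≡⟨ letter≡ l ⟩
      letter l                                ∎))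
    where open ≡-Reasoning

theorem2p6 : ∀ {a : Level} {A : Set a} (N : ℕ) → 3 ≤ N → A ↔ Fin N →
    (σ : A ↔ A) → IsCyclic σ → (a₀ : A) →
    (j : ℕ) → 1 ≤ j → j < N → ¬ (j ≡ 1 ⟨mod N ⟩) →
    StronglyFree 3 (σ ^ᵖ j) (W σ a₀)
-- For j = 1 the excluded congruence says that N divides 0, which always holds.
theorem2p6 N 3≤N A↔Fin σ cyc a₀ (suc zero) 1≤j j<N j≢1 =
  contradiction (N ∣0) j≢1
theorem2p6 N 3≤N A↔Fin σ cyc a₀ j@(suc (suc d)) 1≤j j<N j≢1 U factor rep
  with repetition⇒ShiftsBy (σ ^ᵖ j) (W σ a₀) factor rep
... | m , i , 1≤m , shifts =
  ¬ShiftsBy (Inverse.to σ) (Inverse.to (σ ^ᵖ j)) (W σ a₀)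
    (W-even σ a₀) (W-odd σ a₀) (^ᵖ-comm σ j)
    (cyclic-no-short-period A↔Fin σ cyc 1 (≤-trans (s≤s (s≤s z≤n)) 3≤N))
    -- If σ x = σ^j x, then the letter σ x is fixed by σ^(j - 1), where j - 1 = `suc d` is positive
    -- and below N.
    (λ x e → cyclic-no-short-period A↔Fin σ cyc (suc d) (<-trans (n<1+n _) j<N)
      (Inverse.to σ x) (trans (^ᵖ-comm σ (suc d) x) (sym e)))
    m (<-wellFounded m) 1≤m i shifts
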